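{- For every graph $\Gamma$, every subgroup $G$ of $\operatorname{Aut}(\Gamma)$, every $\lambda\in\mathbb{N}$ and every $\mu\in\{0,\dots,\lambda\}$, we have $$OP_{\Gamma,G}(\lambda,\mu)=\frac{1}{|G|}\sum_{g\in G}P_{\Gamma/g}(\lambda,\mu).$$ In particular, $OP_{\Gamma,G}(\lambda,\mu)$ is a polynomial in $\lambda$ and $\mu$ (that is, for fixed $\Gamma$ and $G$ the function $(\lambda,\mu)\mapsto OP_{\Gamma,G}(\lambda,\mu)$ is given by a polynomial in two variables).
   Context: $\mathbb{N}$ denotes the positive integers. Graphs are finite and undirected and may contain loops and multiple edges. $\operatorname{Aut}(\Gamma)$ is the group of automorphisms of $\Gamma$, viewed as permutations of the vertex set. A $\lambda$-coloring of $\Gamma$ is a map $f$ from the vertex set of $\Gamma$ to $\{1,\dots,\lambda\}$. For $\mu\in\{0,\dots,\lambda\}$, $f$ is $\mu$-proper if for every pair of adjacent vertices $v,w$ of $\Gamma$, either $f(v)\ne f(w)$ or $f(v)=f(w)>\mu$ (a vertex with a loop is adjacent to itself, so it must get a color $>\mu$). The bivariate chromatic polynomial $P_\Gamma(\lambda,\mu)$ is the number of $\mu$-proper $\lambda$-colorings of $\Gamma$. $OP_{\Gamma,G}(\lambda,\mu)$ is defined as the number of equivalence classes of $\mu$-proper $\lambda$-colorings of $\Gamma$ under the action of $G$, where $f$ and $f'$ are equivalent if $f'=f\circ g$ for some $g\in G$. For a permutation $g$ of the vertex set of $\Gamma$, $\Gamma/g$ denotes the graph obtained from $\Gamma$ by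 identifying, for each cycle of the disjoint cycle decomposition of $g$ (fixed points being cycles of length one), all vertices in that cycle to a single vertex (edges between identified vertices become loops), and then replacing parallel edges by single edges. -}

module Defs where

import Algebra.Definitions.RawSemiring as RawSemiring
open import Data.Fin.Base using (Fin; toℕ; fromℕ<; finToFun)
open import Data.Fin.Permutation
  using (Permutation′; _⟨$⟩ʳ_; _⟨$⟩ˡ_; _≈_; id; flip; _∘ₚ_; inverseˡ; inverseʳ)
open import Data.Fin.Properties using (_≟_; all?; any?; pigeonhole; toℕ-fromℕ<; toℕ<n)
open import Data.Integer.Base using (+_)
open import Data.List.Base
  using (List; []; _∷_; map; filter; length; allFin; deduplicate; foldr)
open import Data.List.Membership.Propositional.Properties using (∈-allFin)
import Data.List.Membership.Setoid as Membership
open import Data.List.Relation.Unary.All using (All)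
open import Data.List.Relation.Unary.Any as Any using (Any; here; there)
import Data.List.Relation.Unary.Any.Properties as Any
import Data.List.Relation.Unary.Unique.Setoid as Unique
open import Data.Nat.Base as ℕ using (ℕ; zero; suc; NonZero; _<_; _∸_)
open import Data.Nat.ListAction using (sum)
open import Data.Nat.DivMod using (_%_; m≡m%n+[m/n]*n; m%n<n)
open import Data.Nat.GeneralisedArithmetic using (fold; fold-+)
import Data.Nat.Properties as ℕ
open import Data.Product.Base using (∃; _×_; _,_)
open import Data.Product.Properties using (≡-dec)
open import Data.Rational.Base as ℚ using (ℚ; 0ℚ; _/_)
open import Data.Sum.Base using (_⊎_)
open import Function.Base using (_∘_)
open import Relation.Binary.Bundles using (Setoid)
open import Relation.Binary.Core using (Rel)
open import Relation.Binary.Definitions using (Decidable)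
open import Relation.Binary.Structures using (IsEquivalence)
open import Relation.Binary.PropositionalEquality
  using (_≡_; _≢_; _≗_; refl; sym; trans; cong; module ≡-Reasoning)
open import Relation.Nullary using (Dec; ¬?)
open import Relation.Nullary.Decidable using (map′; _×-dec_; _⊎-dec_; _→-dec_)
open import Level using (0ℓ)

open RawSemiring ℚ.+-*-rawSemiring using (_^_)

private
  variable
    m n : ℕ

-- The pair (v , w) stands for an undirected edge joining v and w, so its
-- orientation carries no meaning; (v , v) is a loop and repeated entries
-- are parallel edges.

record Graph (n : ℕ) : Set where
  constructor graph
  field
    edges : List (Fin n × Fin n)

open Graph public

Joins : Fin n → Fin n → Fin n × Fin n → Set
Joins v w e = e ≡ (v , w) ⊎ e ≡ (w , v)

joins? : (v w : Fin n) (e : Fin n × Fin n) → Dec (Joins v w e)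
joins? v w e = ≡-dec _≟_ _≟_ e (v , w) ⊎-dec ≡-dec _≟_ _≟_ e (w , v)

Adjacent : Graph n → Rel (Fin n) 0ℓ
Adjacent Γ v w = Any (Joins v w) (edges Γ)

adjacent? : (Γ : Graph n) → Decidable (Adjacent Γ)
adjacent? Γ v w = Any.any? (joins? v w) (edges Γ)

multiplicity : Graph n → Fin n → Fin n → ℕ
multiplicity Γ v w = length (filter (joins? v w) (edges Γ))

-- A permutation of the vertices is induced by an automorphism of a graph
-- with parallel edges exactly when it preserves edge multiplicities.

IsAutomorphism : Graph n → Permutation′ n → Set
IsAutomorphism Γ g = ∀ v w →
  multiplicity Γ (g ⟨$⟩ʳ v) (g ⟨$⟩ʳ w) ≡ multiplicity Γ v w

-- Permutations are compared by their underlying functions.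

permutationSetoid : ℕ → Setoid 0ℓ 0ℓ
permutationSetoid n = record
  { Carrier       = Permutation′ n
  ; _≈_           = _≈_
  ; isEquivalence = record
    { refl  = λ _ → refl
    ; sym   = λ p i → sym (p i)
    ; trans = λ p q i → trans (p i) (q i)
    }
  }

module _ {n : ℕ} where
  open Membership (permutationSetoid n) public
    using () renaming (_∈_ to _∈ₚ_)
  open Unique (permutationSetoid n) public
    using () renaming (Unique to Uniqueₚ)

-- A subgroup of Aut Γ, given by listing each of its elements exactly once.

record Subgroup (Γ : Graph n) : Set where
  field
    elements      : List (Permutation′ n)
    unique        : Uniqueₚ elements
    automorphisms : All (IsAutomorphism Γ) elements
    id-closed     : id ∈ₚ elements
    ∘-closed      : ∀ g h → g ∈ₚ elements → h ∈ₚ elements → (g ∘ₚ h) ∈ₚ elements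
    ⁻¹-closed     : ∀ g → g ∈ₚ elements → flip g ∈ₚ elements

open Subgroup public

order : {Γ : Graph n} → Subgroup Γ → ℕ
order G = length (elements G)

order-nonZero : {Γ : Graph n} (G : Subgroup Γ) → NonZero (order G)
order-nonZero G = inhabited (id-closed G)
  where
  inhabited : ∀ {A : Set} {Q : A → Set} {xs : List A} → Any Q xs → NonZero (length xs)
  inhabited (here _)  = _
  inhabited (there _) = _

1/∣_∣ : {Γ : Graph n} → Subgroup Γ → ℚ
1/∣ G ∣ = + 1 / order G
  where instance _ = order-nonZero G

-- Colorings. The element c of Fin ℓ stands for the color toℕ c + 1 of
-- {1, …, ℓ}.

Coloring : ℕ → ℕ → Set
Coloring n ℓ = Fin n → Fin ℓ

color : ∀ {ℓ} → Fin ℓ → ℕ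
color c = suc (toℕ c)

Proper : Graph n → ∀ {ℓ} → ℕ → Coloring n ℓ → Set
Proper Γ μ f = ∀ v w → Adjacent Γ v w →
  f v ≢ f w ⊎ (f v ≡ f w × μ < color (f v))

proper? : (Γ : Graph n) → ∀ {ℓ} (μ : ℕ) (f : Coloring n ℓ) → Dec (Proper Γ μ f)
proper? Γ μ f = all? λ v → all? λ w → adjacent? Γ v w →-dec
  (¬? (f v ≟ f w) ⊎-dec ((f v ≟ f w) ×-dec (μ ℕ.<? color (f v))))

-- finToFun is a bijection from Fin (ℓ ^ n) to the functions Fin n → Fin ℓ
-- (considered up to pointwise equality).

colorings : ∀ n ℓ → List (Coloring n ℓ)
colorings n ℓ = map finToFun (allFin (ℓ ℕ.^ n))

properColorings : Graph n → ∀ ℓ → ℕ → List (Coloring n ℓ)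
properColorings {n} Γ ℓ μ = filter (proper? Γ μ) (colorings n ℓ)

P : Graph n → ℕ → ℕ → ℕ
P Γ ℓ μ = length (properColorings Γ ℓ μ)

module _ {n : ℕ} {Γ : Graph n} (G : Subgroup Γ) {ℓ : ℕ} where
  open Membership (permutationSetoid n) using (find; lose)

  Equivalent : Rel (Coloring n ℓ) 0ℓ
  Equivalent f f′ = Any (λ g → f′ ≗ f ∘ (g ⟨$⟩ʳ_)) (elements G)

  equivalent? : Decidable Equivalent
  equivalent? f f′ = Any.any? (λ g → all? λ v → f′ v ≟ f (g ⟨$⟩ʳ v)) (elements G)

  private
    witness : ∀ f f′ → Equivalent f f′ →
              ∃ λ g → g ∈ₚ elements G × f′ ≗ f ∘ (g ⟨$⟩ʳ_)
    witness _ _ = find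

    equivalent : ∀ f f′ g → g ∈ₚ elements G → f′ ≗ f ∘ (g ⟨$⟩ʳ_) → Equivalent f f′
    equivalent f _ g = lose (λ g≈h p v → trans (p v) (cong f (g≈h v))) {g}

  equivalent-isEquivalence : IsEquivalence Equivalent
  equivalent-isEquivalence = record
    { refl  = λ {f} → equivalent f f id (id-closed G) (λ _ → refl)
    ; sym   = λ {f} {f′} e →
        let (g , g∈G , p) = witness f f′ e
        in equivalent f′ f (flip g) (⁻¹-closed G g g∈G)
             (λ v → sym (trans (p (g ⟨$⟩ˡ v)) (cong f (inverseʳ g))))
    ; trans = λ {f} {f′} {f″} e e′ →
        let (g , g∈G , p) = witness f f′ e
            (h , h∈G , q) = witness f′ f″ e′
        in equivalent f f″ (h ∘ₚ g) (∘-closed G h g h∈G g∈G)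
             (λ v → trans (q v) (p (h ⟨$⟩ʳ v)))
    }

-- Since Equivalent is an equivalence relation, deduplication keeps exactly
-- one coloring from each equivalence class.

OP : (Γ : Graph n) → Subgroup Γ → ℕ → ℕ → ℕ
OP Γ G ℓ μ = length (deduplicate (equivalent? G) (properColorings Γ ℓ μ))

-- Cycles of a permutation, fixed points included.

SameCycle : Permutation′ n → Rel (Fin n) 0ℓ
SameCycle g v w = ∃ λ k → fold v (g ⟨$⟩ʳ_) k ≡ w

module _ (g : Permutation′ n) where
  private
    s : Fin n → Fin n
    s = g ⟨$⟩ʳ_

    fold-injective : ∀ k {v w} → fold v s k ≡ fold w s k → v ≡ w
    fold-injective zero    e = e
    fold-injective (suc k) e = fold-injective k
      (trans (sym (inverseˡ g)) (trans (cong (g ⟨$⟩ˡ_) e) (inverseˡ g)))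

    period : ∀ v → ∃ λ p → NonZero p × p ℕ.≤ n × fold v s p ≡ v
    period v =
      let (i , j , i<j , e) = pigeonhole (ℕ.n<1+n n) (λ i → fold v s (toℕ i))
          p     = toℕ j ∸ toℕ i
          i+p≡j = ℕ.m+[n∸m]≡n (ℕ.<⇒≤ i<j)
      in p
       , ℕ.>-nonZero (ℕ.m<n⇒0<n∸m i<j)
       , ℕ.≤-trans (ℕ.m∸n≤m (toℕ j) (toℕ i)) (ℕ.s≤s⁻¹ (toℕ<n j))
       , sym (fold-injective (toℕ i)
           (trans e (trans (cong (fold v s) (sym i+p≡j)) (fold-+ v s (toℕ i)))))

    fold-multiple : ∀ {v p} → fold v s p ≡ v → ∀ q → fold v s (q ℕ.* p) ≡ v
    fold-multiple         e zero    = refl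
    fold-multiple {v} {p} e (suc q) = trans (fold-+ v s p)
      (trans (cong (λ z → fold z s p) (fold-multiple e q)) e)

    bound : ∀ {v w} → SameCycle g v w → ∃ λ (k : Fin n) → fold v s (toℕ k) ≡ w
    bound {v} {w} (k , vk≡w) with period v
    ... | p , p≢0 , p≤n , vp≡v = fromℕ< r<n , (begin
      fold v s (toℕ (fromℕ< r<n))                  ≡⟨ cong (fold v s) (toℕ-fromℕ< r<n) ⟩
      fold v s (k % p)                             ≡⟨ cong (λ z → fold z s (k % p)) (fold-multiple vp≡v (k ℕ./ p)) ⟨
      fold (fold v s (k ℕ./ p ℕ.* p)) s (k % p)    ≡⟨ fold-+ v s (k % p) ⟨
      fold v s (k % p ℕ.+ k ℕ./ p ℕ.* p)           ≡⟨ cong (fold v s) (m≡m%n+[m/n]*n k p) ⟨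
      fold v s k                                   ≡⟨ vk≡w ⟩
      w                                            ∎)
      where
      open ≡-Reasoning
      instance _ = p≢0
      r<n : k % p < n
      r<n = ℕ.<-≤-trans (m%n<n k p) p≤n

  sameCycle? : Decidable (SameCycle g)
  sameCycle? v w = map′ (λ (k , e) → toℕ k , e) bound
    (any? λ k → fold v s (toℕ k) ≟ w)

  sameCycle-trans : ∀ {u v w} → SameCycle g u v → SameCycle g v w → SameCycle g u w
  sameCycle-trans {u} (k , refl) (l , e) = l ℕ.+ k , trans (fold-+ u s l) e

  -- One vertex from each cycle; the cycles are numbered by position in
  -- this list.

  cycleRepresentatives : List (Fin n)
  cycleRepresentatives = deduplicate sameCycle? (allFin n)

  cycleCount : ℕ
  cycleCount = length cycleRepresentatives

  representative : ∀ v → Any (λ r → SameCycle g r v) cycleRepresentatives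
  representative v = Any.deduplicate⁺ sameCycle?
    (λ y~x x~v → sameCycle-trans y~x x~v)
    (Any.map (λ { refl → 0 , refl }) (∈-allFin v))

  cycleOf : Fin n → Fin cycleCount
  cycleOf v = Any.index (representative v)

identify : Graph n → (Fin n → Fin m) → Graph m
identify Γ q = graph (map (λ (v , w) → q v , q w) (edges Γ))

Parallel : Rel (Fin n × Fin n) 0ℓ
Parallel e (v , w) = Joins v w e

parallel? : Decidable (Parallel {n})
parallel? e (v , w) = joins? v w e

simplify : Graph n → Graph n
simplify Γ = graph (deduplicate parallel? (edges Γ))

infixl 7 _⟋_

_⟋_ : Graph n → (g : Permutation′ n) → Graph (cycleCount g)
Γ ⟋ g = simplify (identify Γ (cycleOf g))

∑ : {Γ : Graph n} → Subgroup Γ → (Permutation′ n → ℕ) → ℕ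
∑ G F = sum (map F (elements G))

fromℕ : ℕ → ℚ
fromℕ k = + k / 1

-- Polynomials in two variables with rational coefficients, as lists of
-- monomials: (c , i , j) stands for c xⁱ yʲ.

Polynomial₂ : Set
Polynomial₂ = List (ℚ × ℕ × ℕ)

⟦_⟧ : Polynomial₂ → ℚ → ℚ → ℚ
⟦ p ⟧ x y = foldr (λ (c , i , j) r → c ℚ.* (x ^ i) ℚ.* (y ^ j) ℚ.+ r) 0ℚ p

{-# OPTIONS --safe #-}
-- Burnside by double counting: with T(r, f) the number of g ∈ G with
-- f = r ∘ g, summing T(r, f) over the orbit representatives r and all proper f gives
-- |G| · OP when f is eliminated first (r ∘ g is proper for each g), and
-- ∑_f |Stab f| = ∑_g |Fix g| when r is (only the representative of f
-- contributes). A coloring fixed by g is constant on the cycles of g, hence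
-- descends to Γ/g, and properness is read off the same edges.
--
-- For polynomiality, P is expanded by deletion–contraction: the colorings not
-- violating e are all colorings less those violating e. What remains are
-- colorings violating a prescribed list of edges, i.e. constant on the
-- components of that list and small on the components having an edge; their
-- number is a monomial ℓⁱ μʲ.

module Submission where

open import Defs
open import Data.Nat.Base using (ℕ; _≤_)
open import Data.Product.Base using (∃; _×_)
open import Data.Rational.Base using (_*_)
open import Relation.Binary.PropositionalEquality using (_≡_)

open import Data.Bool.Base using (if_then_else_)
open import Data.Fin.Base as Fin using (Fin; zero; suc; toℕ; finToFun; funToFin)
open import Data.Fin.Permutation
  using (Permutation′; _⟨$⟩ʳ_; _⟨$⟩ˡ_; id; flip; _∘ₚ_; inverseˡ; inverseʳ)
import Data.Fin.Properties as Fin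
open import Data.Integer.Base as ℤ using (+_)
import Data.Integer.Properties as ℤ
open import Data.List.Base
  using (List; []; _∷_; _++_; map; filter; length; lookup; tabulate; allFin; deduplicate;
         cartesianProduct)
open import Data.List.Membership.Propositional.Properties using (∈-allFin; ∈-lookup)
import Data.List.Membership.Setoid as Membership
import Data.List.Membership.Setoid.Properties as Membershipₚ
open import Data.List.Properties
  using (length-++; length-map; length-tabulate; map-tabulate;
         filter-≐; filter-all; filter-none; filter-some)
open import Data.List.Relation.Unary.All as All using (All; []; _∷_)
import Data.List.Relation.Unary.All.Properties as All
open import Data.List.Relation.Unary.AllPairs using (AllPairs; []; _∷_)
import Data.List.Relation.Unary.AllPairs.Properties as AllPairs
open import Data.List.Relation.Unary.Any as Any using (Any; here; there)
import Data.List.Relation.Unary.Any.Properties as Any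
import Data.List.Relation.Unary.Unique.Propositional.Properties as Unique≡
import Data.List.Relation.Unary.Unique.Setoid as Unique
import Data.List.Relation.Unary.Unique.Setoid.Properties as Uniqueₚ
import Data.Nat.Base as ℕ
open import Data.Nat.GeneralisedArithmetic using (fold; fold-+)
open import Data.Nat.ListAction using (sum)
import Data.Nat.Properties as ℕ
open import Data.Product.Base using (_,_; proj₁; proj₂)
open import Data.Product.Relation.Binary.Pointwise.NonDependent using (_×ₛ_)
open import Data.Rational.Base as ℚ using (ℚ; 0ℚ; 1ℚ; toℚᵘ)
import Data.Rational.Properties as ℚ
import Data.Rational.Unnormalised.Base as ℚᵘ
import Data.Rational.Unnormalised.Properties as ℚᵘ
open import Data.Sum.Base using (inj₁; inj₂)
open import Data.Unit.Base using (tt)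
open import Function.Base using (_∘_)
open import Level using (Level; 0ℓ)
open import Relation.Binary.Bundles using (Setoid)
open import Relation.Binary.Core using (Rel)
import Relation.Binary.Definitions as B
open import Relation.Binary.PropositionalEquality
  using (_≗_; refl; sym; trans; cong; cong₂; subst; setoid; _→-setoid_; module ≡-Reasoning)
open import Relation.Binary.Structures using (IsEquivalence)
open import Relation.Nullary using (Dec; yes; no; ¬_; ¬?; contradiction)
open import Relation.Nullary.Decidable using (does; decidable-stable; _×-dec_)
open import Relation.Unary using (Pred; Decidable)
open import Relation.Unary.Properties using (U?)

open import Algebra.Definitions.RawSemiring ℚ.+-*-rawSemiring using (_^_)
open import Algebra.Properties.CommutativeSemigroup ℕ.+-commutativeSemigroup using (interchange)
open import Algebra.Properties.CommutativeSemigroup ℕ.*-commutativeSemigroup using (x∙yz≈y∙xz)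
open import Algebra.Properties.Ring ℚ.+-*-ring using (-1*x≈-x)

private
  variable
    a b p q r : Level
    A : Set a
    B : Set b
    m n ℓ μ : ℕ

-- Finite sums and lengths of filtered lists

Σ[_]_ : List A → (A → ℕ) → ℕ
Σ[ xs ] F = sum (map F xs)

infix 5 Σ[_]_

Σ-cong : ∀ {F F′ : A → ℕ} {xs} → All (λ x → F x ≡ F′ x) xs → (Σ[ xs ] F) ≡ (Σ[ xs ] F′)
Σ-cong []       = refl
Σ-cong (e ∷ es) = cong₂ ℕ._+_ e (Σ-cong es)

Σ-const : ∀ (xs : List A) k → (Σ[ xs ] λ _ → k) ≡ length xs ℕ.* k
Σ-const []       k = refl
Σ-const (_ ∷ xs) k = cong (k ℕ.+_) (Σ-const xs k)

Σ-zero : ∀ {F : A → ℕ} {xs} → All (λ x → F x ≡ 0) xs → (Σ[ xs ] F) ≡ 0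
Σ-zero {xs = xs} es = trans (Σ-cong es) (trans (Σ-const xs 0) (ℕ.*-zeroʳ (length xs)))

Σ-+ : ∀ (xs : List A) (F F′ : A → ℕ) →
      (Σ[ xs ] λ x → F x ℕ.+ F′ x) ≡ (Σ[ xs ] F) ℕ.+ (Σ[ xs ] F′)
Σ-+ []       F F′ = refl
Σ-+ (x ∷ xs) F F′ = trans (cong (F x ℕ.+ F′ x ℕ.+_) (Σ-+ xs F F′))
  (interchange (F x) (F′ x) (Σ[ xs ] F) (Σ[ xs ] F′))

Σ-swap : ∀ (xs : List A) (ys : List B) (F : A → B → ℕ) →
         (Σ[ xs ] λ x → Σ[ ys ] F x) ≡ (Σ[ ys ] λ y → Σ[ xs ] λ x → F x y)
Σ-swap []       ys F = sym (Σ-zero (All.universal (λ _ → refl) ys))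
Σ-swap (x ∷ xs) ys F = trans (cong ((Σ[ ys ] F x) ℕ.+_) (Σ-swap xs ys F))
  (sym (Σ-+ ys (F x) (λ y → Σ[ xs ] λ x′ → F x′ y)))

-- Entries are pairwise related by `D`, while elements of `Q` never are, so a single entry lies in
-- `Q` and it alone contributes. With `D` as inequivalence this picks one orbit representative; with
-- `D` as pointwise difference it picks one coloring.
Σ-single : ∀ {D : A → A → Set r} {Q : Pred A q} {F : A → ℕ} {k xs} → AllPairs D xs →
           (∀ {x y} → Q x → Q y → ¬ D x y) →
           (∀ {x} → Q x → F x ≡ k) → (∀ {x} → ¬ Q x → F x ≡ 0) →
           Any Q xs → (Σ[ xs ] F) ≡ k
Σ-single {k = k} (ds ∷ _) sep on off (here qx) = trans
  (cong₂ ℕ._+_ (on qx) (Σ-zero (All.map (λ d → off λ qy → sep qx qy d) ds)))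
  (ℕ.+-identityʳ k)
Σ-single (ds ∷ dss) sep on off (there qxs) = cong₂ ℕ._+_
  (off λ qx → let (d , qy) = All.lookupAny ds qxs in sep qx qy d)
  (Σ-single dss sep on off qxs)

-- The Iverson bracket, which turns counts into sums whose order can be exchanged.
[_]₁ : {P : Set p} → Dec P → ℕ
[ P? ]₁ = if does P? then 1 else 0

[yes] : {P : Set p} (P? : Dec P) → P → [ P? ]₁ ≡ 1
[yes] (yes _) _ = refl
[yes] (no ¬p) p = contradiction p ¬p

[no] : {P : Set p} (P? : Dec P) → ¬ P → [ P? ]₁ ≡ 0
[no] (yes p) ¬p = contradiction p ¬p
[no] (no _)  _  = refl

length-filter-Σ : ∀ {P : Pred A p} (P? : Decidable P) xs →
                  length (filter P? xs) ≡ (Σ[ xs ] λ x → [ P? x ]₁)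
length-filter-Σ P? []       = refl
length-filter-Σ P? (x ∷ xs) with P? x
... | yes _ = cong ℕ.suc (length-filter-Σ P? xs)
... | no  _ = length-filter-Σ P? xs

filter-filter : ∀ {P : Pred A p} {Q : Pred A q} (P? : Decidable P) (Q? : Decidable Q) xs →
                filter P? (filter Q? xs) ≡ filter (λ x → P? x ×-dec Q? x) xs
filter-filter P? Q? []       = refl
filter-filter P? Q? (x ∷ xs) with ih ← filter-filter P? Q? xs | Q? x
filter-filter P? Q? (x ∷ xs) | yes _ with P? x
... | yes _ = cong (x ∷_) ih
... | no  _ = ih
filter-filter P? Q? (x ∷ xs) | no  _ with P? x
... | yes _ = ih
... | no  _ = ih

-- The four conditions say that `Q` and `R` partition `P`. This form of the deletion-contraction
-- identity avoids truncated subtraction.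
filter-split : ∀ {P : Pred A p} {Q : Pred A q} {R : Pred A r}
               (P? : Decidable P) (Q? : Decidable Q) (R? : Decidable R) →
               (∀ {x} → Q x → P x) → (∀ {x} → R x → P x) →
               (∀ {x} → Q x → ¬ R x) → (∀ {x} → P x → ¬ Q x → R x) → ∀ xs →
               length (filter Q? xs) ℕ.+ length (filter R? xs) ≡ length (filter P? xs)
filter-split P? Q? R? Q⇒P R⇒P Q⇒¬R P¬Q⇒R []       = refl
filter-split P? Q? R? Q⇒P R⇒P Q⇒¬R P¬Q⇒R (x ∷ xs)
  with ih ← filter-split P? Q? R? Q⇒P R⇒P Q⇒¬R P¬Q⇒R xs | P? x | Q? x | R? x
... | yes _ | yes _ | no _   = cong ℕ.suc ih
... | yes _ | no _  | yes _  = trans (ℕ.+-suc _ _) (cong ℕ.suc ih)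
... | no _  | no _  | no _   = ih
... | yes p | no ¬q | no ¬r  = contradiction (P¬Q⇒R p ¬q) ¬r
... | _     | yes q | yes r  = contradiction r (Q⇒¬R q)
... | no ¬p | yes q | _      = contradiction (Q⇒P q) ¬p
... | no ¬p | _     | yes r  = contradiction (R⇒P r) ¬p

-- Comparing lengths of lists along injections and bijections

module _ {c ℓ₁} (S : Setoid c ℓ₁) where
  open Setoid S using (_≈_) renaming (sym to ≈-sym)

  unique⇒lookup-injective : ∀ {xs} → Unique.Unique S xs →
                            ∀ {i j} → lookup xs i ≈ lookup xs j → i ≡ j
  unique⇒lookup-injective (_  ∷ _) {zero}  {zero}  _ = refl
  unique⇒lookup-injective (ds ∷ _) {zero}  {suc j} e = contradiction e (All.lookup ds (∈-lookup j))
  unique⇒lookup-injective (ds ∷ _) {suc i} {zero}  e =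
    contradiction (≈-sym e) (All.lookup ds (∈-lookup i))
  unique⇒lookup-injective (_  ∷ u) {suc i} {suc j} e = cong suc (unique⇒lookup-injective u e)

module _ {c ℓ₁ d ℓ₂} (S : Setoid c ℓ₁) (T : Setoid d ℓ₂) where
  private
    module S = Setoid S
    module T = Setoid T
  open Membership S using () renaming (_∈_ to _∈₁_)
  open Membership T using () renaming (_∈_ to _∈₂_)

  -- Sending a position in `xs` to the position of the image in `ys` is an injection between finite
  -- sets. Setoids are used because colorings and permutations are compared only pointwise.
  injection⇒length≤ : ∀ {xs ys} (to : S.Carrier → T.Carrier) → Unique.Unique S xs →
    (∀ {x} → x ∈₁ xs → to x ∈₂ ys) →
    (∀ {x x′} → x ∈₁ xs → x′ ∈₁ xs → to x T.≈ to x′ → x S.≈ x′) →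
    length xs ≤ length ys
  injection⇒length≤ {xs} {ys} to xs! to-∈ inj = Fin.injective⇒≤ {f = position} λ {i} {j} e →
    unique⇒lookup-injective S xs! (inj (∈xs i) (∈xs j)
      (T.trans (Any.lookup-index (to-∈ (∈xs i)))
        (T.trans (T.reflexive (cong (lookup ys) e)) (T.sym (Any.lookup-index (to-∈ (∈xs j)))))))
    where
    ∈xs : ∀ i → lookup xs i ∈₁ xs
    ∈xs = Membershipₚ.∈-lookup S xs
    position : Fin (length xs) → Fin (length ys)
    position i = Any.index (to-∈ (∈xs i))

module _ {c ℓ₁ d ℓ₂} (S : Setoid c ℓ₁) (T : Setoid d ℓ₂) where
  private
    module S = Setoid S
    module T = Setoid T
  open Membership S using () renaming (_∈_ to _∈₁_)
  open Membership T using () renaming (_∈_ to _∈₂_)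

  -- The inverse laws are asked for on listed elements only: restricting a coloring to
  -- representatives and pulling it back recovers it only if it is constant on classes.
  bijection⇒length≡ : ∀ {xs ys} (to : S.Carrier → T.Carrier) (from : T.Carrier → S.Carrier) →
    (∀ {x x′} → x S.≈ x′ → to x T.≈ to x′) → (∀ {y y′} → y T.≈ y′ → from y S.≈ from y′) →
    Unique.Unique S xs → Unique.Unique T ys →
    (∀ {x} → x ∈₁ xs → to x ∈₂ ys) → (∀ {y} → y ∈₂ ys → from y ∈₁ xs) →
    (∀ {x} → x ∈₁ xs → from (to x) S.≈ x) → (∀ {y} → y ∈₂ ys → to (from y) T.≈ y) →
    length xs ≡ length ys
  bijection⇒length≡ to from to-cong from-cong xs! ys! to-∈ from-∈ from∘to to∘from = ℕ.≤-antisym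
    (injection⇒length≤ S T to xs! to-∈ λ x∈ x′∈ e →
      S.trans (S.sym (from∘to x∈)) (S.trans (from-cong e) (from∘to x′∈)))
    (injection⇒length≤ T S from ys! from-∈ λ y∈ y′∈ e →
      T.trans (T.sym (to∘from y∈)) (T.trans (to-cong e) (to∘from y′∈)))

deduplicate-distinct : ∀ {R : Rel A r} (R? : B.Decidable R) xs →
                       AllPairs (λ x y → ¬ R x y) (deduplicate R? xs)
deduplicate-distinct R? []       = []
deduplicate-distinct R? (x ∷ xs) =
  All.all-filter (¬? ∘ R? x) (deduplicate R? xs) ∷
  AllPairs.filter⁺ (¬? ∘ R? x) (deduplicate-distinct R? xs)

length-cartesianProduct : ∀ (xs : List A) (ys : List B) →
                          length (cartesianProduct xs ys) ≡ length xs ℕ.* length ys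
length-cartesianProduct []       ys = refl
length-cartesianProduct (x ∷ xs) ys = trans (length-++ (map (x ,_) ys))
  (cong₂ ℕ._+_ (length-map (x ,_) ys) (length-cartesianProduct xs ys))

-- Counting colorings

coloringSetoid : ℕ → ℕ → Setoid 0ℓ 0ℓ
coloringSetoid n ℓ = Fin n →-setoid Fin ℓ

module _ {n ℓ : ℕ} where
  open Membership (coloringSetoid n ℓ) public using () renaming (_∈_ to _∈ᶜ_)
  open Unique (coloringSetoid n ℓ) public using () renaming (Unique to Uniqueᶜ)

  _≗?_ : (f f′ : Coloring n ℓ) → Dec (f ≗ f′)
  f ≗? f′ = Fin.all? λ v → f v Fin.≟ f′ v

  -- A coloring occurs in `colorings` only up to pointwise equality, so membership in a filtered
  -- list reflects a predicate when the predicate respects that equality.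
  Extensional : Pred (Coloring n ℓ) p → Set p
  Extensional Q = ∀ {f f′} → f ≗ f′ → Q f → Q f′

funToFin-cong : {f f′ : Fin n → Fin ℓ} → f ≗ f′ → funToFin f ≡ funToFin f′
funToFin-cong {ℕ.zero}  e = refl
funToFin-cong {ℕ.suc n} e = cong₂ Fin.combine (e zero) (funToFin-cong (e ∘ suc))

finToFun-injective : {i j : Fin (ℓ ℕ.^ n)} → finToFun {ℓ} {n} i ≗ finToFun j → i ≡ j
finToFun-injective {ℓ} {n} {i} {j} e = trans (sym (Fin.funToFin-finToFin {n} {ℓ} i))
  (trans (funToFin-cong e) (Fin.funToFin-finToFin {n} {ℓ} j))

colorings-unique : ∀ n ℓ → Uniqueᶜ (colorings n ℓ)
colorings-unique n ℓ = Uniqueₚ.map⁺ (setoid _) (coloringSetoid n ℓ)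
  (finToFun-injective {ℓ} {n}) (Unique≡.allFin⁺ (ℓ ℕ.^ n))

∈-colorings : (f : Coloring n ℓ) → f ∈ᶜ colorings n ℓ
∈-colorings f = Any.map⁺ (Any.map (λ { refl v → sym (Fin.finToFun-funToFin f v) })
  (∈-allFin (funToFin f)))

count : {Q : Pred (Coloring n ℓ) q} → Decidable Q → ℕ
count {n} {ℓ} Q? = length (filter Q? (colorings n ℓ))

module _ {Q : Pred (Coloring n ℓ) q} (Q? : Decidable Q) where

  filter-colorings-unique : Uniqueᶜ (filter Q? (colorings n ℓ))
  filter-colorings-unique = Uniqueₚ.filter⁺ (coloringSetoid n ℓ) Q? (colorings-unique n ℓ)

  ∈-filter-colorings⁺ : Extensional Q → ∀ {f} → Q f → f ∈ᶜ filter Q? (colorings n ℓ)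
  ∈-filter-colorings⁺ ext {f} = Membershipₚ.∈-filter⁺ (coloringSetoid n ℓ) Q? ext (∈-colorings f)

  ∈-filter-colorings⁻ : Extensional Q → ∀ {f} → f ∈ᶜ filter Q? (colorings n ℓ) → Q f
  ∈-filter-colorings⁻ ext = proj₂ ∘
    Membershipₚ.∈-filter⁻ (coloringSetoid n ℓ) Q? ext {xs = colorings n ℓ}

-- Precomposition with `s` and with `t` are inverse on the counted colorings, even where `s` and `t`
-- themselves are not. This serves both the quotient by a permutation and the merging of two
-- vertices.
count-reindex : {Q : Pred (Coloring n ℓ) q} (Q? : Decidable Q) → Extensional Q →
  {R : Pred (Coloring m ℓ) r} (R? : Decidable R) → Extensional R →
  (s : Fin m → Fin n) (t : Fin n → Fin m) →
  (∀ {f} → Q f → R (f ∘ s)) → (∀ {f} → R f → Q (f ∘ t)) →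
  (∀ {f} → Q f → f ∘ s ∘ t ≗ f) → (∀ {f} → R f → f ∘ t ∘ s ≗ f) →
  count Q? ≡ count R?
count-reindex Q? Q-ext R? R-ext s t Q⇒R R⇒Q st ts =
  bijection⇒length≡ (coloringSetoid _ _) (coloringSetoid _ _) (_∘ s) (_∘ t)
    (_∘ s) (_∘ t) (filter-colorings-unique Q?) (filter-colorings-unique R?)
    (∈-filter-colorings⁺ R? R-ext ∘ Q⇒R ∘ ∈-filter-colorings⁻ Q? Q-ext)
    (∈-filter-colorings⁺ Q? Q-ext ∘ R⇒Q ∘ ∈-filter-colorings⁻ R? R-ext)
    (st ∘ ∈-filter-colorings⁻ Q? Q-ext)
    (ts ∘ ∈-filter-colorings⁻ R? R-ext)

infixr 5 _∷ᶜ_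

_∷ᶜ_ : Fin ℓ → Coloring n ℓ → Coloring (ℕ.suc n) ℓ
(c ∷ᶜ f) zero    = c
(c ∷ᶜ f) (suc v) = f v

-- A coloring is the color of vertex `zero` together with a coloring of the other vertices; when the
-- condition separates accordingly, the count is a product.
count-product : {S : Pred (Fin ℓ) p} (S? : Decidable S)
  {Q : Pred (Coloring n ℓ) q} (Q? : Decidable Q) → Extensional Q →
  {R : Pred (Coloring (ℕ.suc n) ℓ) r} (R? : Decidable R) → Extensional R →
  (∀ {f} → R f → S (f zero) × Q (f ∘ suc)) → (∀ {f} → S (f zero) × Q (f ∘ suc) → R f) →
  count R? ≡ length (filter S? (allFin ℓ)) ℕ.* count Q?
count-product {ℓ} {n = n} {S} S? {Q} Q? Q-ext {R} R? R-ext R⇒SQ SQ⇒R = trans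
  (bijection⇒length≡ (coloringSetoid _ _) (setoid _ ×ₛ coloringSetoid _ _)
    (λ f → f zero , f ∘ suc) (λ (c , f) → c ∷ᶜ f)
    (λ e → e zero , e ∘ suc) (λ { (e , es) zero → e ; (e , es) (suc v) → es v })
    (filter-colorings-unique R?)
    (Uniqueₚ.cartesianProduct⁺ (setoid _) (coloringSetoid _ _)
      (Unique≡.filter⁺ S? (Unique≡.allFin⁺ ℓ)) (filter-colorings-unique Q?))
    (λ f∈ → let (s , q) = R⇒SQ (∈-filter-colorings⁻ R? R-ext f∈) in
      Membershipₚ.∈-cartesianProduct⁺ (setoid _) (coloringSetoid _ _)
        (Membershipₚ.∈-filter⁺ (setoid _) S? (λ { refl s → s }) (∈-allFin _) s)
        (∈-filter-colorings⁺ Q? Q-ext q))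
    (λ cf∈ → let (c∈ , f∈) = Membershipₚ.∈-cartesianProduct⁻ (setoid _) (coloringSetoid _ _)
                               (filter S? (allFin ℓ)) (filter Q? (colorings n ℓ)) cf∈ in
      ∈-filter-colorings⁺ R? R-ext (SQ⇒R
        ( proj₂ (Membershipₚ.∈-filter⁻ (setoid _) S? (λ { refl s → s }) {xs = allFin ℓ} c∈)
        , ∈-filter-colorings⁻ Q? Q-ext f∈)))
    (λ { _ zero → refl ; _ (suc v) → refl }) (λ _ → refl , λ _ → refl))
  (length-cartesianProduct (filter S? (allFin ℓ)) (filter Q? (colorings n ℓ)))

-- Violated edges

-- The negation, in positive form, of what `Proper` demands of an adjacent pair.
Bad : ℕ → Coloring n ℓ → Fin n × Fin n → Set
Bad μ f (v , w) = f v ≡ f w × color (f v) ≤ μ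

bad? : ∀ μ (f : Coloring n ℓ) e → Dec (Bad μ f e)
bad? μ f (v , w) = (f v Fin.≟ f w) ×-dec (color (f v) ℕ.≤? μ)

Bad-ext : ∀ e → Extensional {n} {ℓ} (λ f → Bad μ f e)
Bad-ext {μ = μ} (v , w) f≗f′ (fv≡fw , small) =
  trans (sym (f≗f′ v)) (trans fv≡fw (f≗f′ w)) , subst (λ c → color c ≤ μ) (f≗f′ v) small

Bad-swap : ∀ {f : Coloring n ℓ} v w → Bad μ f (v , w) → Bad μ f (w , v)
Bad-swap {μ = μ} v w (fv≡fw , small) = sym fv≡fw , subst (λ c → color c ≤ μ) fv≡fw small

AllBad-ext : ∀ es → Extensional {n} {ℓ} (λ f → All (Bad μ f) es)
AllBad-ext es f≗f′ = All.map (λ {e} → Bad-ext e f≗f′)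

AllGood-ext : ∀ es → Extensional {n} {ℓ} (λ f → All (λ e → ¬ Bad μ f e) es)
AllGood-ext es f≗f′ = All.map (λ {e} ¬bad → ¬bad ∘ Bad-ext e (λ v → sym (f≗f′ v)))

proper⇒good : ∀ (Γ : Graph n) {f : Coloring n ℓ} →
              Proper Γ μ f → All (λ e → ¬ Bad μ f e) (edges Γ)
proper⇒good Γ {f} proper = All.tabulate λ {e} e∈ → good e (Any.map (λ { refl → inj₁ refl }) e∈)
  where
  good : ∀ e → Adjacent Γ (proj₁ e) (proj₂ e) → ¬ Bad _ f e
  good (v , w) adj (fv≡fw , small) with proper v w adj
  ... | inj₁ fv≢fw       = fv≢fw fv≡fw
  ... | inj₂ (_ , large) = ℕ.<⇒≱ large small

-- The edge witnessing adjacency may be stored in either orientation, which is harmless because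
-- `Bad` is symmetric in the endpoints.
good⇒proper : ∀ (Γ : Graph n) {f : Coloring n ℓ} →
              All (λ e → ¬ Bad μ f e) (edges Γ) → Proper Γ μ f
good⇒proper {μ = μ} Γ {f} good v w adj with f v Fin.≟ f w
... | no  fv≢fw = inj₁ fv≢fw
... | yes fv≡fw = inj₂ (fv≡fw , ℕ.≰⇒> λ small → bad small (All.lookupAny good adj))
  where
  bad : color (f v) ≤ μ → ∀ {e} → ¬ (¬ Bad μ f e × Joins v w e)
  bad small (good , inj₁ refl) = good (fv≡fw , small)
  bad small (good , inj₂ refl) = good (Bad-swap {f = f} v w (fv≡fw , small))

Proper-ext : ∀ (Γ : Graph n) → Extensional {n} {ℓ} (Proper Γ μ)
Proper-ext Γ f≗f′ = good⇒proper Γ ∘ AllGood-ext (edges Γ) f≗f′ ∘ proper⇒good Γ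

-- Colorings of the quotient by a permutation

module _ (g : Permutation′ n) where
  private
    s : Fin n → Fin n
    s = g ⟨$⟩ʳ_

    s-injective : ∀ {v w} → s v ≡ s w → v ≡ w
    s-injective e = trans (sym (inverseˡ g)) (trans (cong (g ⟨$⟩ˡ_) e) (inverseˡ g))

    -- Injectivity of `s` cancels the `i` common steps and leaves a positive number of steps leading
    -- back to `v`.
    repetition⇒return : ∀ {v} i j → i ℕ.< j → fold v s i ≡ fold v s j →
                        ∃ λ p → fold v s (ℕ.suc p) ≡ v
    repetition⇒return ℕ.zero    (ℕ.suc j) _         e = j , sym e
    repetition⇒return (ℕ.suc i) (ℕ.suc j) (ℕ.s≤s l) e = repetition⇒return i j l (s-injective e)

  -- `SameCycle` only iterates forwards, so a step is undone by completing the cycle: by the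
  -- pigeonhole principle some `p + 1` steps return to `v`, and `p` of them start at `s v`.
  sameCycle-step⁻ : ∀ v → SameCycle g (s v) v
  sameCycle-step⁻ v =
    let (i , j , i<j , e) = Fin.pigeonhole (ℕ.n<1+n n) (λ i → fold v s (toℕ i))
        (p , returns)     = repetition⇒return (toℕ i) (toℕ j) i<j e
    in p , trans (sym (fold-+ v s p)) (trans (cong (fold v s) (ℕ.+-comm p 1)) returns)

  sameCycle-refl : ∀ {v} → SameCycle g v v
  sameCycle-refl = 0 , refl

  sameCycle-sym : ∀ {v w} → SameCycle g v w → SameCycle g w v
  sameCycle-sym {v} (ℕ.zero  , refl) = sameCycle-refl
  sameCycle-sym {v} (ℕ.suc k , refl) =
    sameCycle-trans g (sameCycle-step⁻ (fold v s k)) (sameCycle-sym (k , refl))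

  sameCycleSetoid : Setoid 0ℓ 0ℓ
  sameCycleSetoid = record
    { Carrier       = Fin n
    ; _≈_           = SameCycle g
    ; isEquivalence = record
      { refl  = sameCycle-refl
      ; sym   = sameCycle-sym
      ; trans = sameCycle-trans g
      }
    }

  cycleRepresentative : Fin (cycleCount g) → Fin n
  cycleRepresentative = lookup (cycleRepresentatives g)

  cycleRepresentative-sameCycle : ∀ v → SameCycle g (cycleRepresentative (cycleOf g v)) v
  cycleRepresentative-sameCycle v = Any.lookup-index (representative g v)

  cycleRepresentative-injective : ∀ {i j} →
    SameCycle g (cycleRepresentative i) (cycleRepresentative j) → i ≡ j
  cycleRepresentative-injective = unique⇒lookup-injective sameCycleSetoid
    (deduplicate-distinct (sameCycle? g) (allFin n))

  cycleOf-cycleRepresentative : ∀ i → cycleOf g (cycleRepresentative i) ≡ i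
  cycleOf-cycleRepresentative i = cycleRepresentative-injective (cycleRepresentative-sameCycle _)

  cycleOf-step : ∀ v → cycleOf g (s v) ≡ cycleOf g v
  cycleOf-step v = cycleRepresentative-injective
    (sameCycle-trans g (cycleRepresentative-sameCycle (s v))
      (sameCycle-trans g (sameCycle-step⁻ v) (sameCycle-sym (cycleRepresentative-sameCycle v))))

  fixed⇒constantOnCycles : ∀ {f : Coloring n ℓ} → f ≗ f ∘ s →
                           ∀ {v w} → SameCycle g v w → f v ≡ f w
  fixed⇒constantOnCycles fixed (ℕ.zero  , refl) = refl
  fixed⇒constantOnCycles fixed {v} (ℕ.suc k , refl) =
    trans (fixed⇒constantOnCycles fixed (k , refl)) (fixed (fold v s k))

simplify-identify-good⁺ : ∀ (Γ : Graph n) (q : Fin n → Fin m) {f : Coloring m ℓ} →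
  All (λ e → ¬ Bad μ (f ∘ q) e) (edges Γ) → All (λ e → ¬ Bad μ f e) (edges (simplify (identify Γ q)))
simplify-identify-good⁺ Γ q = All.deduplicate⁺ parallel? ∘ All.map⁺

-- Each edge dropped by `deduplicate` is parallel to a kept one, and being good does not depend on
-- the orientation.
simplify-identify-good⁻ : ∀ (Γ : Graph n) (q : Fin n → Fin m) {f : Coloring m ℓ} →
  All (λ e → ¬ Bad μ f e) (edges (simplify (identify Γ q))) → All (λ e → ¬ Bad μ (f ∘ q) e) (edges Γ)
simplify-identify-good⁻ {μ = μ} Γ q {f} = All.map⁻ ∘ All.deduplicate⁻ parallel?
  (λ { (inj₁ refl) good → good ; {_} {v , w} (inj₂ refl) good → good ∘ Bad-swap {μ = μ} {f = f} v w }) _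

-- A coloring fixed by `g` is constant on cycles, hence recovered from its values on cycle
-- representatives; conversely a coloring of the quotient pulls back along `cycleOf g` to a fixed
-- one.
count-fixed : ∀ (Γ : Graph n) (g : Permutation′ n) ℓ μ →
  length (filter (λ f → f ≗? (f ∘ (g ⟨$⟩ʳ_))) (properColorings Γ ℓ μ)) ≡ P (Γ ⟋ g) ℓ μ
count-fixed {n} Γ g ℓ μ = trans
  (cong length (filter-filter (λ f → f ≗? (f ∘ (g ⟨$⟩ʳ_))) (proper? Γ μ) (colorings n ℓ)))
  (count-reindex (λ f → (f ≗? (f ∘ (g ⟨$⟩ʳ_))) ×-dec proper? Γ μ f)
    (λ e (fixed , proper) →
      (λ v → trans (sym (e v)) (trans (fixed v) (e _))) , Proper-ext Γ e proper)
    (proper? (Γ ⟋ g) μ) (Proper-ext (Γ ⟋ g))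
    (cycleRepresentative g) (cycleOf g)
    (λ (fixed , proper) → good⇒proper (Γ ⟋ g) (simplify-identify-good⁺ Γ (cycleOf g)
      (AllGood-ext (edges Γ)
        (λ v → sym (fixed⇒constantOnCycles g fixed (cycleRepresentative-sameCycle g v)))
        (proper⇒good Γ proper))))
    (λ {f} proper → (λ v → cong f (sym (cycleOf-step g v))) ,
      good⇒proper Γ (simplify-identify-good⁻ Γ (cycleOf g) (proper⇒good (Γ ⟋ g) proper)))
    (λ (fixed , _) v → fixed⇒constantOnCycles g fixed (cycleRepresentative-sameCycle g v))
    (λ {f} _ i → cong f (cycleOf-cycleRepresentative g i)))

-- The group action on proper colorings and the double count

module _ (Γ : Graph n) (g : Permutation′ n) (auto : IsAutomorphism Γ g) where

  -- Adjacency means positive multiplicity, and multiplicity is preserved.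
  automorphism⇒adjacent : ∀ {v w} → Adjacent Γ v w → Adjacent Γ (g ⟨$⟩ʳ v) (g ⟨$⟩ʳ w)
  automorphism⇒adjacent {v} {w} adj with adjacent? Γ (g ⟨$⟩ʳ v) (g ⟨$⟩ʳ w)
  ... | yes adj′ = adj′
  ... | no ¬adj′ = contradiction
    (subst (0 ℕ.<_) (trans (sym (auto v w))
      (cong length (filter-none (joins? _ _) (All.¬Any⇒All¬ _ ¬adj′))))
      (filter-some (joins? v w) adj))
    λ ()

  proper-∘ : {f : Coloring n ℓ} → Proper Γ μ f → Proper Γ μ (f ∘ (g ⟨$⟩ʳ_))
  proper-∘ proper v w adj = proper _ _ (automorphism⇒adjacent adj)

module _ {Γ : Graph n} (G : Subgroup Γ) where
  open Membership (permutationSetoid n) using (find; lose)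

  ≗⇒equivalent : (r f : Coloring n ℓ) → f ≗ r → Equivalent G r f
  ≗⇒equivalent r f = lose {P = λ g → f ≗ r ∘ (g ⟨$⟩ʳ_)}
    (λ g≈h p v → trans (p v) (cong r (g≈h v))) {id} (id-closed G)

  -- The number T(r, f) of the double count; for `r = f` it is the order of the stabilizer of `f`.
  transporters : Coloring n ℓ → Coloring n ℓ → ℕ
  transporters r f = Σ[ elements G ] λ g → [ f ≗? (r ∘ (g ⟨$⟩ʳ_)) ]₁

  transporters-inequivalent : (r f : Coloring n ℓ) → ¬ Equivalent G r f → transporters r f ≡ 0
  transporters-inequivalent r f r≁f = Σ-zero
    (All.map (λ {g} → [no] (f ≗? (r ∘ (g ⟨$⟩ʳ_)))) (All.¬Any⇒All¬ _ r≁f))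

  -- If `f = r ∘ h`, the transporters from `r` to `f` form a coset of the stabilizer of `f`. Since
  -- `∘ₚ` applies its left factor first, `g ∘ₚ flip h` is the inverse of `h` after `g`, which fixes
  -- `f`.
  transporters-equivalent : (r f : Coloring n ℓ) → Equivalent G r f →
                            transporters r f ≡ transporters f f
  transporters-equivalent r f r~f with h , h∈G , f≗r∘h ← find {P = λ g → f ≗ r ∘ (g ⟨$⟩ʳ_)} r~f = begin
    transporters r f
      ≡⟨ length-filter-Σ (carries? r) (elements G) ⟨
    length (filter (carries? r) (elements G))
      ≡⟨ bijection⇒length≡ S S (_∘ₚ flip h) (_∘ₚ h)
           (λ e v → cong (h ⟨$⟩ˡ_) (e v)) (λ e v → cong (h ⟨$⟩ʳ_) (e v))
           (Uniqueₚ.filter⁺ S (carries? r) (unique G)) (Uniqueₚ.filter⁺ S (carries? f) (unique G))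
           (λ {g} g∈ → let (g∈G , p) = ∈-carriers⁻ r g g∈ in
             ∈-carriers⁺ f (g ∘ₚ flip h) (∘-closed G g (flip h) g∈G (⁻¹-closed G h h∈G))
               (λ v → trans (p v) (sym (trans (f≗r∘h _) (cong r (inverseʳ h))))))
           (λ {g} g∈ → let (g∈G , p) = ∈-carriers⁻ f g g∈ in
             ∈-carriers⁺ r (g ∘ₚ h) (∘-closed G g h g∈G h∈G)
               (λ v → trans (p v) (f≗r∘h _)))
           (λ _ _ → inverseʳ h) (λ _ _ → inverseˡ h) ⟩
    length (filter (carries? f) (elements G))
      ≡⟨ length-filter-Σ (carries? f) (elements G) ⟩
    transporters f f ∎
    where
    open ≡-Reasoning
    S = permutationSetoid n
    Carries : Coloring n _ → Permutation′ n → Set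
    Carries r g = f ≗ r ∘ (g ⟨$⟩ʳ_)
    carries? : (r : Coloring n _) → Decidable (Carries r)
    carries? r g = f ≗? (r ∘ (g ⟨$⟩ʳ_))
    carries-resp : ∀ r {g g′} → Setoid._≈_ S g g′ → Carries r g → Carries r g′
    carries-resp r g≈g′ p v = trans (p v) (cong r (g≈g′ v))
    ∈-carriers⁺ : ∀ r g → g ∈ₚ elements G → Carries r g → g ∈ₚ filter (carries? r) (elements G)
    ∈-carriers⁺ r g = Membershipₚ.∈-filter⁺ S (carries? r)
      (λ {g} {g′} → carries-resp r {g} {g′}) {v = g}
    ∈-carriers⁻ : ∀ r g → g ∈ₚ filter (carries? r) (elements G) → g ∈ₚ elements G × Carries r g
    ∈-carriers⁻ r g = Membershipₚ.∈-filter⁻ S (carries? r)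
      (λ {g} {g′} → carries-resp r {g} {g′}) {v = g} {xs = elements G}

  module _ (ℓ μ : ℕ) where
    private
      xs reps : List (Coloring n ℓ)
      xs   = properColorings Γ ℓ μ
      reps = deduplicate (equivalent? G) xs

      module ~ = IsEquivalence (equivalent-isEquivalence G {ℓ})

    -- Some representative is equivalent to `f`, and two such would be equivalent to each other,
    -- which deduplication excludes.
    Σ-transporters-reps : ∀ f → f ∈ᶜ xs → (Σ[ reps ] λ r → transporters r f) ≡ transporters f f
    Σ-transporters-reps f f∈ = Σ-single (deduplicate-distinct (equivalent? G) xs)
      (λ {r} {r′} r~f r′~f r≁r′ →
        r≁r′ (~.trans {r} {f} {r′} r~f (~.sym {r′} {f} r′~f)))
      (λ {r} → transporters-equivalent r f) (λ {r} → transporters-inequivalent r f)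
      (Any.deduplicate⁺ (equivalent? G) (λ {r} {r′} → ~.trans {r′} {r} {f})
        (Any.map (≗⇒equivalent _ f) f∈))

    -- The only candidate is `r ∘ g`, which is again proper and so is listed exactly once.
    count-∘ : ∀ {r} → Proper Γ μ r → ∀ {g} → IsAutomorphism Γ g →
              (Σ[ xs ] λ f → [ f ≗? (r ∘ (g ⟨$⟩ʳ_)) ]₁) ≡ 1
    count-∘ {r} proper {g} auto = Σ-single (filter-colorings-unique (proper? Γ μ))
      (λ p q p≢q → p≢q λ v → trans (p v) (sym (q v)))
      ([yes] (_ ≗? _)) ([no] (_ ≗? _))
      (Any.map (λ e v → sym (e v))
        (∈-filter-colorings⁺ (proper? Γ μ) (Proper-ext Γ) (proper-∘ Γ g auto proper)))

    order*OP : order G ℕ.* OP Γ G ℓ μ ≡ ∑ G (λ g → P (Γ ⟋ g) ℓ μ)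
    order*OP = begin
      order G ℕ.* length reps
        ≡⟨ ℕ.*-comm (order G) (length reps) ⟩
      length reps ℕ.* order G
        ≡⟨ Σ-const reps (order G) ⟨
      (Σ[ reps ] λ _ → order G)
        -- For a fixed representative each group element accounts for exactly one proper coloring,
        -- so the two inner sums give the order of `G`.
        ≡⟨ Σ-cong (All.map (λ {r} proper → trans
             (Σ-cong (All.map (λ {g} → count-∘ proper {g}) (automorphisms G)))
             (trans (Σ-const (elements G) 1) (ℕ.*-identityʳ (order G))))
             (All.deduplicate⁺ (equivalent? G) (All.all-filter (proper? Γ μ) (colorings n ℓ)))) ⟨
      (Σ[ reps ] λ r → Σ[ elements G ] λ g → Σ[ xs ] λ f → [ f ≗? (r ∘ (g ⟨$⟩ʳ_)) ]₁)
        ≡⟨ Σ-cong (All.universal (λ r → Σ-swap (elements G) xs _) reps) ⟩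
      (Σ[ reps ] λ r → Σ[ xs ] transporters r)
        ≡⟨ Σ-swap reps xs transporters ⟩
      (Σ[ xs ] λ f → Σ[ reps ] λ r → transporters r f)
        ≡⟨ Σ-cong (All.tabulate λ f∈ → Σ-transporters-reps _ (Any.map (λ { refl _ → refl }) f∈)) ⟩
      (Σ[ xs ] λ f → transporters f f)
        ≡⟨ Σ-swap xs (elements G) _ ⟩
      (Σ[ elements G ] λ g → Σ[ xs ] λ f → [ f ≗? (f ∘ (g ⟨$⟩ʳ_)) ]₁)
        ≡⟨ Σ-cong (All.universal (λ g → trans
             (sym (length-filter-Σ (λ f → f ≗? (f ∘ (g ⟨$⟩ʳ_))) xs)) (count-fixed Γ g ℓ μ))
             (elements G)) ⟩
      ∑ G (λ g → P (Γ ⟋ g) ℓ μ) ∎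
      where open ≡-Reasoning

-- Natural numbers and their reciprocals in the rationals

toℚᵘ-/ : ∀ i n-1 → toℚᵘ (i ℚ./ ℕ.suc n-1) ℚᵘ.≃ ℚᵘ.mkℚᵘ i n-1
toℚᵘ-/ i n-1 = ℚ.toℚᵘ-fromℚᵘ (ℚᵘ.mkℚᵘ i n-1)

-- Rational division normalises by a gcd, so the identity is checked on unnormalised fractions,
-- where it is an equation of integers.
fromℕ-+ : ∀ k l → fromℕ (k ℕ.+ l) ≡ fromℕ k ℚ.+ fromℕ l
fromℕ-+ k l = ℚ.toℚᵘ-injective (begin
  toℚᵘ (fromℕ (k ℕ.+ l))                ≈⟨ toℚᵘ-/ (+ (k ℕ.+ l)) 0 ⟩
  ℚᵘ.mkℚᵘ (+ (k ℕ.+ l)) 0               ≈⟨ ℚᵘ.*≡* (cong (ℤ._* + 1) (sym k*1+l*1≡k+l)) ⟩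
  ℚᵘ.mkℚᵘ (+ k) 0 ℚᵘ.+ ℚᵘ.mkℚᵘ (+ l) 0  ≈⟨ ℚᵘ.+-cong (toℚᵘ-/ (+ k) 0) (toℚᵘ-/ (+ l) 0) ⟨
  toℚᵘ (fromℕ k) ℚᵘ.+ toℚᵘ (fromℕ l)    ≈⟨ ℚ.toℚᵘ-homo-+ (fromℕ k) (fromℕ l) ⟨
  toℚᵘ (fromℕ k ℚ.+ fromℕ l)            ∎)
  where
  open ℚᵘ.≃-Reasoning
  k*1+l*1≡k+l : + k ℤ.* + 1 ℤ.+ + l ℤ.* + 1 ≡ + (k ℕ.+ l)
  k*1+l*1≡k+l = cong₂ ℤ._+_ (ℤ.*-identityʳ (+ k)) (ℤ.*-identityʳ (+ l))

fromℕ-* : ∀ k l → fromℕ (k ℕ.* l) ≡ fromℕ k * fromℕ l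
fromℕ-* k l = ℚ.toℚᵘ-injective (begin
  toℚᵘ (fromℕ (k ℕ.* l))                ≈⟨ toℚᵘ-/ (+ (k ℕ.* l)) 0 ⟩
  ℚᵘ.mkℚᵘ (+ (k ℕ.* l)) 0               ≈⟨ ℚᵘ.*≡* (cong (ℤ._* + 1) (ℤ.pos-* k l)) ⟩
  ℚᵘ.mkℚᵘ (+ k) 0 ℚᵘ.* ℚᵘ.mkℚᵘ (+ l) 0  ≈⟨ ℚᵘ.*-cong (toℚᵘ-/ (+ k) 0) (toℚᵘ-/ (+ l) 0) ⟨
  toℚᵘ (fromℕ k) ℚᵘ.* toℚᵘ (fromℕ l)    ≈⟨ ℚ.toℚᵘ-homo-* (fromℕ k) (fromℕ l) ⟨
  toℚᵘ (fromℕ k * fromℕ l)              ∎)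
  where open ℚᵘ.≃-Reasoning

1/n*n : ∀ n .{{_ : ℕ.NonZero n}} → (+ 1 ℚ./ n) * fromℕ n ≡ 1ℚ
1/n*n n@(ℕ.suc n-1) = ℚ.toℚᵘ-injective (begin
  toℚᵘ ((+ 1 ℚ./ n) * fromℕ n)            ≈⟨ ℚ.toℚᵘ-homo-* (+ 1 ℚ./ n) (fromℕ n) ⟩
  toℚᵘ (+ 1 ℚ./ n) ℚᵘ.* toℚᵘ (fromℕ n)    ≈⟨ ℚᵘ.*-cong (toℚᵘ-/ (+ 1) n-1) (toℚᵘ-/ (+ n) 0) ⟩
  ℚᵘ.mkℚᵘ (+ 1) n-1 ℚᵘ.* ℚᵘ.mkℚᵘ (+ n) 0  ≈⟨ ℚᵘ.*-inverseˡ (ℚᵘ.mkℚᵘ (+ n) 0) ⟩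
  ℚᵘ.1ℚᵘ                                  ∎)
  where open ℚᵘ.≃-Reasoning

OP-average : ∀ {Γ : Graph n} (G : Subgroup Γ) ℓ μ →
             fromℕ (OP Γ G ℓ μ) ≡ 1/∣ G ∣ * fromℕ (∑ G (λ g → P (Γ ⟋ g) ℓ μ))
OP-average {Γ = Γ} G ℓ μ = begin
  fromℕ (OP Γ G ℓ μ)                                ≡⟨ ℚ.*-identityˡ _ ⟨
  1ℚ * fromℕ (OP Γ G ℓ μ)                           ≡⟨ cong (_* fromℕ (OP Γ G ℓ μ)) (1/n*n (order G)) ⟨
  1/∣ G ∣ * fromℕ (order G) * fromℕ (OP Γ G ℓ μ)    ≡⟨ ℚ.*-assoc 1/∣ G ∣ _ _ ⟩
  1/∣ G ∣ * (fromℕ (order G) * fromℕ (OP Γ G ℓ μ))  ≡⟨ cong (1/∣ G ∣ *_) (fromℕ-* (order G) _) ⟨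
  1/∣ G ∣ * fromℕ (order G ℕ.* OP Γ G ℓ μ)          ≡⟨ cong ((1/∣ G ∣ *_) ∘ fromℕ) (order*OP G ℓ μ) ⟩
  1/∣ G ∣ * fromℕ (∑ G (λ g → P (Γ ⟋ g) ℓ μ))       ∎
  where
  open ≡-Reasoning
  instance _ = order-nonZero G

-- Polynomiality

⟦++⟧ : ∀ p q x y → ⟦ p ++ q ⟧ x y ≡ ⟦ p ⟧ x y ℚ.+ ⟦ q ⟧ x y
⟦++⟧ []      q x y = sym (ℚ.+-identityˡ _)
⟦++⟧ ((c , i , j) ∷ p) q x y =
  trans (cong (t ℚ.+_) (⟦++⟧ p q x y)) (sym (ℚ.+-assoc t (⟦ p ⟧ x y) (⟦ q ⟧ x y)))
  where t = c * (x ^ i) * (y ^ j)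

scale : ℚ → Polynomial₂ → Polynomial₂
scale k = map λ (c , ij) → k * c , ij

⟦scale⟧ : ∀ k p x y → ⟦ scale k p ⟧ x y ≡ k * ⟦ p ⟧ x y
⟦scale⟧ k []                x y = sym (ℚ.*-zeroʳ k)
⟦scale⟧ k ((c , i , j) ∷ p) x y = begin
  k * c * (x ^ i) * (y ^ j) ℚ.+ ⟦ scale k p ⟧ x y
    ≡⟨ cong₂ ℚ._+_
         (trans (cong (_* (y ^ j)) (ℚ.*-assoc k c (x ^ i))) (ℚ.*-assoc k (c * (x ^ i)) (y ^ j)))
         (⟦scale⟧ k p x y) ⟩
  k * (c * (x ^ i) * (y ^ j)) ℚ.+ k * ⟦ p ⟧ x y
    ≡⟨ ℚ.*-distribˡ-+ k _ (⟦ p ⟧ x y) ⟨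
  k * (c * (x ^ i) * (y ^ j) ℚ.+ ⟦ p ⟧ x y) ∎
  where open ≡-Reasoning

fromℕ-^ : ∀ k i → fromℕ (k ℕ.^ i) ≡ fromℕ k ^ i
fromℕ-^ k ℕ.zero    = refl
fromℕ-^ k (ℕ.suc i) = trans (fromℕ-* k (k ℕ.^ i)) (cong (fromℕ k *_) (fromℕ-^ k i))

-- The range `μ ≤ ℓ` is the one on which exactly `μ` of the `ℓ` colors are at most `μ`.
record IsPolynomial (F : ℕ → ℕ → ℕ) : Set where
  constructor _,_
  field
    polynomial : Polynomial₂
    represents : ∀ ℓ μ → μ ≤ ℓ → fromℕ (F ℓ μ) ≡ ⟦ polynomial ⟧ (fromℕ ℓ) (fromℕ μ)

module _ {F F′ : ℕ → ℕ → ℕ} where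

  polynomial-resp : (∀ ℓ μ → μ ≤ ℓ → F ℓ μ ≡ F′ ℓ μ) → IsPolynomial F′ → IsPolynomial F
  polynomial-resp F≡F′ (p , p-eq) =
    p , λ ℓ μ μ≤ℓ → trans (cong fromℕ (F≡F′ ℓ μ μ≤ℓ)) (p-eq ℓ μ μ≤ℓ)

  polynomial-+ : IsPolynomial F → IsPolynomial F′ → IsPolynomial (λ ℓ μ → F ℓ μ ℕ.+ F′ ℓ μ)
  polynomial-+ (p , p-eq) (p′ , p′-eq) = p ++ p′ , λ ℓ μ μ≤ℓ → trans (fromℕ-+ (F ℓ μ) (F′ ℓ μ))
    (trans (cong₂ ℚ._+_ (p-eq ℓ μ μ≤ℓ) (p′-eq ℓ μ μ≤ℓ)) (sym (⟦++⟧ p p′ _ _)))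

  -- Subtraction is carried out on the rational side, by adding the second polynomial scaled by
  -- minus one.
  polynomial-+-cancelʳ : IsPolynomial (λ ℓ μ → F ℓ μ ℕ.+ F′ ℓ μ) → IsPolynomial F′ → IsPolynomial F
  polynomial-+-cancelʳ (p , p-eq) (p′ , p′-eq) = p ++ scale (ℚ.- 1ℚ) p′ , λ ℓ μ μ≤ℓ → begin
    fromℕ (F ℓ μ)
      ≡⟨ ℚ.+-identityʳ _ ⟨
    fromℕ (F ℓ μ) ℚ.+ 0ℚ
      ≡⟨ cong (fromℕ (F ℓ μ) ℚ.+_) (ℚ.+-inverseʳ (fromℕ (F′ ℓ μ))) ⟨
    fromℕ (F ℓ μ) ℚ.+ (fromℕ (F′ ℓ μ) ℚ.- fromℕ (F′ ℓ μ))
      ≡⟨ ℚ.+-assoc (fromℕ (F ℓ μ)) (fromℕ (F′ ℓ μ)) _ ⟨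
    fromℕ (F ℓ μ) ℚ.+ fromℕ (F′ ℓ μ) ℚ.- fromℕ (F′ ℓ μ)
      ≡⟨ cong₂ ℚ._+_ (trans (sym (fromℕ-+ (F ℓ μ) (F′ ℓ μ))) (p-eq ℓ μ μ≤ℓ))
           (trans (sym (-1*x≈-x (fromℕ (F′ ℓ μ)))) (cong ((ℚ.- 1ℚ) *_) (p′-eq ℓ μ μ≤ℓ))) ⟩
    ⟦ p ⟧ (fromℕ ℓ) (fromℕ μ) ℚ.+ (ℚ.- 1ℚ) * ⟦ p′ ⟧ (fromℕ ℓ) (fromℕ μ)
      ≡⟨ cong (⟦ p ⟧ (fromℕ ℓ) (fromℕ μ) ℚ.+_) (⟦scale⟧ (ℚ.- 1ℚ) p′ _ _) ⟨
    ⟦ p ⟧ (fromℕ ℓ) (fromℕ μ) ℚ.+ ⟦ scale (ℚ.- 1ℚ) p′ ⟧ (fromℕ ℓ) (fromℕ μ)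
      ≡⟨ ⟦++⟧ p (scale (ℚ.- 1ℚ) p′) _ _ ⟨
    ⟦ p ++ scale (ℚ.- 1ℚ) p′ ⟧ (fromℕ ℓ) (fromℕ μ) ∎
    where open ≡-Reasoning

polynomial-Σ : ∀ (xs : List A) {F : A → ℕ → ℕ → ℕ} → (∀ x → IsPolynomial (F x)) →
               IsPolynomial (λ ℓ μ → Σ[ xs ] λ x → F x ℓ μ)
polynomial-Σ []       F-poly = [] , λ _ _ _ → refl
polynomial-Σ (x ∷ xs) F-poly = polynomial-+ (F-poly x) (polynomial-Σ xs F-poly)

polynomial-monomial : ∀ i j → IsPolynomial (λ ℓ μ → ℓ ℕ.^ i ℕ.* μ ℕ.^ j)
polynomial-monomial i j = (1ℚ , i , j) ∷ [] , λ ℓ μ _ → begin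
  fromℕ (ℓ ℕ.^ i ℕ.* μ ℕ.^ j)                 ≡⟨ fromℕ-* (ℓ ℕ.^ i) (μ ℕ.^ j) ⟩
  fromℕ (ℓ ℕ.^ i) * fromℕ (μ ℕ.^ j)           ≡⟨ cong₂ _*_ (fromℕ-^ ℓ i) (fromℕ-^ μ j) ⟩
  (fromℕ ℓ ^ i) * (fromℕ μ ^ j)               ≡⟨ cong (_* (fromℕ μ ^ j)) (ℚ.*-identityˡ (fromℕ ℓ ^ i)) ⟨
  1ℚ * (fromℕ ℓ ^ i) * (fromℕ μ ^ j)          ≡⟨ ℚ.+-identityʳ _ ⟨
  1ℚ * (fromℕ ℓ ^ i) * (fromℕ μ ^ j) ℚ.+ 0ℚ   ∎
  where open ≡-Reasoning

-- Colorings violating a prescribed list of edges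

small-colors : μ ≤ ℓ → length (filter (λ c → color c ℕ.≤? μ) (allFin ℓ)) ≡ μ
small-colors {μ} {ℓ} μ≤ℓ = trans (length-filter-Σ (λ c → color c ℕ.≤? μ) (allFin ℓ))
  (trans (cong sum (map-tabulate {n = ℓ} (λ c → c) _)) (sum-small μ≤ℓ))
  where
  sum-small : ∀ {ℓ μ} → μ ≤ ℓ → sum (tabulate {n = ℓ} λ c → [ color c ℕ.≤? μ ]₁) ≡ μ
  sum-small {ℕ.zero}  ℕ.z≤n       = refl
  sum-small {ℕ.suc ℓ} ℕ.z≤n       = sum-small {ℓ} ℕ.z≤n
  -- Color 1 is counted, and the other colors shift down by one together with the bound.
  sum-small {ℕ.suc ℓ} (ℕ.s≤s μ≤ℓ) = cong ℕ.suc (sum-small μ≤ℓ)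

all-colors : ∀ ℓ → length (filter U? (allFin ℓ)) ≡ ℓ
all-colors ℓ = trans
  (cong length (filter-all U? (All.universal (λ _ → tt) (allFin ℓ))))
  (length-tabulate {n = ℓ} (λ c → c))

AllBad : List (Fin n × Fin n) → ℕ → Coloring n ℓ → Set
AllBad B μ f = All (Bad μ f) B

allBad? : ∀ B μ → Decidable (AllBad {n} {ℓ} B μ)
allBad? B μ f = All.all? (bad? μ f) B

-- What violating all of `B` demands of vertex `zero`: to share the color of another vertex, to have
-- a color at most `μ`, or nothing. In the last two cases `B′` collects the edges among the
-- remaining vertices.
data FirstVertex (B : List (Fin (ℕ.suc n) × Fin (ℕ.suc n))) : Set where
  linked : ∀ w →
    (∀ {ℓ μ} {f : Coloring _ ℓ} → AllBad B μ f → f zero ≡ f (suc w)) →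
    FirstVertex B
  looped : ∀ B′ →
    (∀ {ℓ μ} {f : Coloring _ ℓ} → AllBad B μ f → color (f zero) ≤ μ × AllBad B′ μ (f ∘ suc)) →
    (∀ {ℓ μ} {f : Coloring _ ℓ} → color (f zero) ≤ μ × AllBad B′ μ (f ∘ suc) → AllBad B μ f) →
    FirstVertex B
  isolated : ∀ B′ →
    (∀ {ℓ μ} {f : Coloring _ ℓ} → AllBad B μ f → AllBad B′ μ (f ∘ suc)) →
    (∀ {ℓ μ} {f : Coloring _ ℓ} → AllBad B′ μ (f ∘ suc) → AllBad B μ f) →
    FirstVertex B

firstVertex : (B : List (Fin (ℕ.suc n) × Fin (ℕ.suc n))) → FirstVertex B
firstVertex [] = isolated [] (λ _ → []) (λ _ → [])
firstVertex ((zero , suc w) ∷ B) = linked w λ { ((e , _) ∷ _) → e }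
firstVertex ((suc v , zero) ∷ B) = linked v λ { ((e , _) ∷ _) → sym e }
firstVertex ((zero , zero) ∷ B) with firstVertex B
... | linked w eq       = linked w λ { (_ ∷ bs) → eq bs }
... | looped B′ to from = looped B′ (λ { (_ ∷ bs) → to bs })
  (λ (small , bs) → (refl , small) ∷ from (small , bs))
-- Here the loop is the only edge at vertex `zero`, so it introduces the bound on the color.
... | isolated B′ to from = looped B′ (λ { ((_ , small) ∷ bs) → small , to bs })
  (λ (small , bs) → (refl , small) ∷ from bs)
firstVertex ((suc v , suc w) ∷ B) with firstVertex B
... | linked u eq       = linked u λ { (_ ∷ bs) → eq bs }
... | looped B′ to from = looped ((v , w) ∷ B′)
  (λ { (b ∷ bs) → proj₁ (to bs) , b ∷ proj₂ (to bs) })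
  (λ { (small , b ∷ bs) → b ∷ from (small , bs) })
... | isolated B′ to from = isolated ((v , w) ∷ B′)
  (λ { (b ∷ bs) → b ∷ to bs }) (λ { (b ∷ bs) → b ∷ from bs })

-- Vertices are eliminated one by one: an isolated vertex contributes a factor `ℓ`, a vertex with
-- only loops a factor `μ`, and a linked vertex is merged into a neighbor. Thus `i` counts the
-- components of `B` without edges and `j` those with an edge.
count-allBad : ∀ (B : List (Fin n × Fin n)) → ∃ λ i → ∃ λ j → ∀ ℓ μ → μ ≤ ℓ →
               count {n} {ℓ} (allBad? B μ) ≡ ℓ ℕ.^ i ℕ.* μ ℕ.^ j
count-allBad {ℕ.zero}  []             = 0 , 0 , λ _ _ _ → refl
count-allBad {ℕ.zero}  ((() , _) ∷ _)
count-allBad {ℕ.suc n} B with firstVertex B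
... | isolated B′ to from =
  let (i , j , ih) = count-allBad B′ in
  ℕ.suc i , j , λ ℓ μ μ≤ℓ → begin
    count {ℓ = ℓ} (allBad? B μ)
      ≡⟨ count-product {ℓ = ℓ} U? (allBad? B′ μ) (AllBad-ext B′)
           (allBad? B μ) (AllBad-ext B) (λ bs → tt , to bs) (λ (_ , bs) → from bs) ⟩
    length (filter U? (allFin ℓ)) ℕ.* count (allBad? B′ μ)
      ≡⟨ cong₂ ℕ._*_ (all-colors ℓ) (ih ℓ μ μ≤ℓ) ⟩
    ℓ ℕ.* (ℓ ℕ.^ i ℕ.* μ ℕ.^ j)
      ≡⟨ ℕ.*-assoc ℓ (ℓ ℕ.^ i) (μ ℕ.^ j) ⟨
    ℓ ℕ.^ ℕ.suc i ℕ.* μ ℕ.^ j ∎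
  where open ≡-Reasoning
... | looped B′ to from =
  let (i , j , ih) = count-allBad B′ in
  i , ℕ.suc j , λ ℓ μ μ≤ℓ → begin
    count {ℓ = ℓ} (allBad? B μ)
      ≡⟨ count-product {ℓ = ℓ} (λ c → color c ℕ.≤? μ) (allBad? B′ μ) (AllBad-ext B′)
           (allBad? B μ) (AllBad-ext B) to from ⟩
    length (filter (λ c → color c ℕ.≤? μ) (allFin ℓ)) ℕ.* count (allBad? B′ μ)
      ≡⟨ cong₂ ℕ._*_ (small-colors μ≤ℓ) (ih ℓ μ μ≤ℓ) ⟩
    μ ℕ.* (ℓ ℕ.^ i ℕ.* μ ℕ.^ j)
      ≡⟨ x∙yz≈y∙xz μ (ℓ ℕ.^ i) (μ ℕ.^ j) ⟩
    ℓ ℕ.^ i ℕ.* μ ℕ.^ ℕ.suc j ∎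
  where open ≡-Reasoning
... | linked w eq =
  -- The linking edge stays in the list as a loop at `w`, so the bound on the common color is kept.
  let (i , j , ih) = count-allBad (map (λ (u , v) → merge u , merge v) B) in
  i , j , λ ℓ μ μ≤ℓ → trans
    (count-reindex (allBad? B μ) (AllBad-ext B) (allBad? _ μ) (AllBad-ext _) suc merge
      (λ bs → All.map⁺ (AllBad-ext B (λ v → sym (split bs v)) bs)) All.map⁻
      split (λ _ _ → refl))
    (ih ℓ μ μ≤ℓ)
  where
  -- Violating all of B forces f zero ≡ f (suc w), so vertex zero is merged into w.
  merge : Fin (ℕ.suc n) → Fin n
  merge zero    = w
  merge (suc v) = v
  split : ∀ {ℓ μ} {f : Coloring _ ℓ} → AllBad B μ f → f ∘ suc ∘ merge ≗ f
  split bs zero    = sym (eq bs)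
  split bs (suc v) = refl

-- Deletion-contraction

Constrained : (E B : List (Fin n × Fin n)) → ℕ → Coloring n ℓ → Set
Constrained E B μ f = All (λ e → ¬ Bad μ f e) E × AllBad B μ f

constrained? : ∀ E B μ → Decidable (Constrained {n} {ℓ} E B μ)
constrained? E B μ f = All.all? (λ e → ¬? (bad? μ f e)) E ×-dec allBad? B μ f

-- Edges move from `E` to `B` or disappear: colorings constrained by `E` and `B` split into those
-- for which `e` is good and those for which it is bad, so the first count is a difference of two
-- with a shorter `E`.
count-constrained-polynomial : ∀ (E B : List (Fin n × Fin n)) →
  IsPolynomial (λ ℓ μ → count {n} {ℓ} (constrained? E B μ))
count-constrained-polynomial {n} [] B =
  let (i , j , eq) = count-allBad B in
  polynomial-resp
    (λ ℓ μ μ≤ℓ → trans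
      (cong length (filter-≐ (constrained? [] B μ) (allBad? B μ) (proj₂ , ([] ,_)) (colorings n ℓ)))
      (eq ℓ μ μ≤ℓ))
    (polynomial-monomial i j)
count-constrained-polynomial {n} (e ∷ E) B = polynomial-+-cancelʳ
  (polynomial-resp
    (λ ℓ μ _ → filter-split (constrained? E B μ) (constrained? (e ∷ E) B μ) (constrained? E (e ∷ B) μ)
      (λ { (_ ∷ gs , bs) → gs , bs }) (λ { (gs , _ ∷ bs) → gs , bs })
      (λ { (g ∷ _ , _) (_ , b ∷ _) → g b })
      -- Decidability of `Bad` turns the failure of goodness at `e` into an actual violation.
      (λ { {f} (gs , bs) ¬Q → gs , decidable-stable (bad? μ f e) (λ ¬b → ¬Q (¬b ∷ gs , bs)) ∷ bs })
      (colorings n ℓ))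
    (count-constrained-polynomial E B))
  (count-constrained-polynomial E (e ∷ B))

P-polynomial : ∀ (Γ : Graph n) → IsPolynomial (P Γ)
P-polynomial {n} Γ = polynomial-resp
  (λ ℓ μ _ → cong length (filter-≐ (proper? Γ μ) (constrained? (edges Γ) [] μ)
    ((λ proper → proper⇒good Γ proper , []) , λ (good , _) → good⇒proper Γ good) (colorings n ℓ)))
  (count-constrained-polynomial (edges Γ) [])

theorem1 : ∀ {n : ℕ} (Γ : Graph n) (G : Subgroup Γ) →
    (∀ (ℓ μ : ℕ) → 1 ≤ ℓ → μ ≤ ℓ →
    fromℕ (OP Γ G ℓ μ) ≡ 1/∣ G ∣ * fromℕ (∑ G (λ g → P (Γ ⟋ g) ℓ μ)))
    ×
    (∃ λ (p : Polynomial₂) → ∀ (ℓ μ : ℕ) → 1 ≤ ℓ → μ ≤ ℓ →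
    fromℕ (OP Γ G ℓ μ) ≡ ⟦ p ⟧ (fromℕ ℓ) (fromℕ μ))
theorem1 Γ G =
  let p , p-eq = polynomial-Σ (elements G) (λ g → P-polynomial (Γ ⟋ g)) in
    (λ ℓ μ _ _ → OP-average G ℓ μ)
  -- The sum over `G` is represented by `p`; dividing by the order of `G` scales its coefficients.
  , (scale 1/∣ G ∣ p , λ ℓ μ _ μ≤ℓ → trans (OP-average G ℓ μ)
      (trans (cong (1/∣ G ∣ *_) (p-eq ℓ μ μ≤ℓ)) (sym (⟦scale⟧ 1/∣ G ∣ p _ _))))
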